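{- Let $H$ be a linear intersecting hypergraph of rank $4$ without isolated vertices. Then $\gamma(H)=3$ if and only if $H$ is isomorphic to one of $F_1$, $F_1^-$, $F_2$, $F_3$.
   Context: A hypergraph $H=(V(H),E(H))$ is a finite set $V(H)$ together with a collection $E(H)$ of subsets of $V(H)$ (edges); hypergraphs have no multiple edges and every edge has at least $2$ vertices. The rank is the maximum edge size. $H$ is intersecting if any two edges intersect, and linear if any two distinct edges share at most one vertex. The degree of a vertex is the number of edges containing it; isolated means degree $0$. Two vertices are adjacent if some edge contains both; $D\subseteq V(H)$ is dominating if every vertex of $V(H)\setminus D$ is adjacent to a vertex of $D$; $\gamma(H)$ is the minimum size of a dominating set. The Fano plane $F$ is the $3$-uniform hypergraph on $7$ vertices whose $7$ edges are the lines of the projective plane of order $2$; $F^-$ is obtained from $F$ by deleting one edge (keeping all $7$ vertices). $F_1$ (resp. $F_1^-$) is obtained from $F$ (resp. $F^-$) by adding to each edge a new vertex, distinct new vertices for distinct edges (so each edge becomes a $4$-edge containing one new vertex of degree $1$). $F_2$ is obtained from $F_1$ by removing from one edge its degree-$1$ vertex (that edge becomes a $3$-edge). $F_3$ is obtained from $F_1^-$ by adding a new edge $f=\{x_1,x_2,x_3,x_4\}$ where $x_1,x_2,x_3,x_4$ lie in distinct edges of $F_1^-$, $x_1,x_2$ have degree $2$ in $F_1^-$, and $x_3,x_4$ have degree $1$ in $F_1^-$. -}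

module Defs where

open import Data.Nat using (ℕ; _≤_)
open import Data.Fin using (Fin; #_)
open import Data.Fin.Subset using (Subset; _∈_; _∉_; ∣_∣; ⁅_⁆; _∪_; ⊥)
open import Data.List using (List; []; _∷_; foldr)
open import Data.Product using (Σ; ∃; ∃-syntax; _×_)
open import Function.Bundles using (_⤖_; _⇔_; module Bijection)
open import Function.Definitions using (Injective)
open import Relation.Binary.PropositionalEquality using (_≡_; _≢_)

record Hypergraph : Set where
  field
    n    : ℕ
    m    : ℕ
    edge : Fin m → Subset n

open Hypergraph public

WellFormed : Hypergraph → Set
WellFormed H = Injective _≡_ _≡_ (edge H) × (∀ e → 2 ≤ ∣ edge H e ∣)

HasRank : Hypergraph → ℕ → Set
HasRank H r = (∀ e → ∣ edge H e ∣ ≤ r) × (∃[ e ] ∣ edge H e ∣ ≡ r)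

Intersecting : Hypergraph → Set
Intersecting H = ∀ e f → ∃[ v ] (v ∈ edge H e × v ∈ edge H f)

Linear : Hypergraph → Set
Linear H = ∀ e f → e ≢ f → ∀ u v →
  u ∈ edge H e → v ∈ edge H e → u ∈ edge H f → v ∈ edge H f → u ≡ v

Isolated : (H : Hypergraph) → Fin (n H) → Set
Isolated H v = ∀ e → v ∉ edge H e

NoIsolated : Hypergraph → Set
NoIsolated H = ∀ v → ∃[ e ] v ∈ edge H e

Adjacent : (H : Hypergraph) → Fin (n H) → Fin (n H) → Set
Adjacent H u v = ∃[ e ] (u ∈ edge H e × v ∈ edge H e)

Dominating : (H : Hypergraph) → Subset (n H) → Set
Dominating H D = ∀ v → v ∉ D → ∃[ u ] (u ∈ D × Adjacent H u v)

DominationNumber : Hypergraph → ℕ → Set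
DominationNumber H k =
  (∃[ D ] (Dominating H D × ∣ D ∣ ≡ k)) × (∀ D → Dominating H D → k ≤ ∣ D ∣)

_≅_ : Hypergraph → Hypergraph → Set
H ≅ H' = Σ (Fin (n H) ⤖ Fin (n H')) λ σ →
  (∀ e → ∃[ e' ] (∀ v → (v ∈ edge H e) ⇔ (Bijection.to σ v ∈ edge H' e'))) ×
  (∀ e' → ∃[ e ] (∀ v → (v ∈ edge H e) ⇔ (Bijection.to σ v ∈ edge H' e')))

set : ∀ {k} → List (Fin k) → Subset k
set = foldr (λ x s → ⁅ x ⁆ ∪ s) ⊥

-- Fano lines on {0..6}:
--  {0,1,2} {0,3,4} {0,5,6} {1,3,5} {1,4,6} {2,3,6} {2,4,5}
-- F₁ : 14 vertices; edge i = line i ∪ {7+i}.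
F₁ : Hypergraph
F₁ = record { n = 14 ; m = 7 ; edge = E }
  where
  E : Fin 7 → Subset 14
  E Fin.zero = set (# 0 ∷ # 1 ∷ # 2 ∷ # 7 ∷ [])
  E (Fin.suc Fin.zero) = set (# 0 ∷ # 3 ∷ # 4 ∷ # 8 ∷ [])
  E (Fin.suc (Fin.suc Fin.zero)) = set (# 0 ∷ # 5 ∷ # 6 ∷ # 9 ∷ [])
  E (Fin.suc (Fin.suc (Fin.suc Fin.zero))) = set (# 1 ∷ # 3 ∷ # 5 ∷ # 10 ∷ [])
  E (Fin.suc (Fin.suc (Fin.suc (Fin.suc Fin.zero)))) = set (# 1 ∷ # 4 ∷ # 6 ∷ # 11 ∷ [])
  E (Fin.suc (Fin.suc (Fin.suc (Fin.suc (Fin.suc Fin.zero))))) = set (# 2 ∷ # 3 ∷ # 6 ∷ # 12 ∷ [])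
  E (Fin.suc (Fin.suc (Fin.suc (Fin.suc (Fin.suc (Fin.suc Fin.zero)))))) = set (# 2 ∷ # 4 ∷ # 5 ∷ # 13 ∷ [])

-- F₁⁻ : F⁻ = F minus line {2,4,5}; 13 vertices; edge i = line i ∪ {7+i}.
F₁⁻ : Hypergraph
F₁⁻ = record { n = 13 ; m = 6 ; edge = E }
  where
  E : Fin 6 → Subset 13
  E Fin.zero = set (# 0 ∷ # 1 ∷ # 2 ∷ # 7 ∷ [])
  E (Fin.suc Fin.zero) = set (# 0 ∷ # 3 ∷ # 4 ∷ # 8 ∷ [])
  E (Fin.suc (Fin.suc Fin.zero)) = set (# 0 ∷ # 5 ∷ # 6 ∷ # 9 ∷ [])
  E (Fin.suc (Fin.suc (Fin.suc Fin.zero))) = set (# 1 ∷ # 3 ∷ # 5 ∷ # 10 ∷ [])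
  E (Fin.suc (Fin.suc (Fin.suc (Fin.suc Fin.zero)))) = set (# 1 ∷ # 4 ∷ # 6 ∷ # 11 ∷ [])
  E (Fin.suc (Fin.suc (Fin.suc (Fin.suc (Fin.suc Fin.zero))))) = set (# 2 ∷ # 3 ∷ # 6 ∷ # 12 ∷ [])

-- F₂ : F₁ with the degree-1 vertex (13) of the edge {2,4,5,13} removed
-- (the vertex is deleted, so 13 vertices).
F₂ : Hypergraph
F₂ = record { n = 13 ; m = 7 ; edge = E }
  where
  E : Fin 7 → Subset 13
  E Fin.zero = set (# 0 ∷ # 1 ∷ # 2 ∷ # 7 ∷ [])
  E (Fin.suc Fin.zero) = set (# 0 ∷ # 3 ∷ # 4 ∷ # 8 ∷ [])
  E (Fin.suc (Fin.suc Fin.zero)) = set (# 0 ∷ # 5 ∷ # 6 ∷ # 9 ∷ [])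
  E (Fin.suc (Fin.suc (Fin.suc Fin.zero))) = set (# 1 ∷ # 3 ∷ # 5 ∷ # 10 ∷ [])
  E (Fin.suc (Fin.suc (Fin.suc (Fin.suc Fin.zero)))) = set (# 1 ∷ # 4 ∷ # 6 ∷ # 11 ∷ [])
  E (Fin.suc (Fin.suc (Fin.suc (Fin.suc (Fin.suc Fin.zero))))) = set (# 2 ∷ # 3 ∷ # 6 ∷ # 12 ∷ [])
  E (Fin.suc (Fin.suc (Fin.suc (Fin.suc (Fin.suc (Fin.suc Fin.zero)))))) = set (# 2 ∷ # 4 ∷ # 5 ∷ [])

-- F₃ : F₁⁻ plus f = {2,4,9,10}: 2,4 have degree 2 in F₁⁻, 9,10 have
-- degree 1, and 2,4,9,10 lie in the four distinct edges
-- {0,1,2,7}, {0,3,4,8}, {0,5,6,9}, {1,3,5,10}.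
F₃ : Hypergraph
F₃ = record { n = 13 ; m = 7 ; edge = E }
  where
  E : Fin 7 → Subset 13
  E Fin.zero = set (# 0 ∷ # 1 ∷ # 2 ∷ # 7 ∷ [])
  E (Fin.suc Fin.zero) = set (# 0 ∷ # 3 ∷ # 4 ∷ # 8 ∷ [])
  E (Fin.suc (Fin.suc Fin.zero)) = set (# 0 ∷ # 5 ∷ # 6 ∷ # 9 ∷ [])
  E (Fin.suc (Fin.suc (Fin.suc Fin.zero))) = set (# 1 ∷ # 3 ∷ # 5 ∷ # 10 ∷ [])
  E (Fin.suc (Fin.suc (Fin.suc (Fin.suc Fin.zero)))) = set (# 1 ∷ # 4 ∷ # 6 ∷ # 11 ∷ [])
  E (Fin.suc (Fin.suc (Fin.suc (Fin.suc (Fin.suc Fin.zero))))) = set (# 2 ∷ # 3 ∷ # 6 ∷ # 12 ∷ [])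
  E (Fin.suc (Fin.suc (Fin.suc (Fin.suc (Fin.suc (Fin.suc Fin.zero)))))) = set (# 2 ∷ # 4 ∷ # 9 ∷ # 10 ∷ [])

{-# OPTIONS --safe #-}
module Submission where

-- A vertex of degree at least 4 would dominate, and some vertex x has degree 3. Applying the absence
-- of dominating pairs three times to x yields three edges off x that meet pairwise on the edges
-- through x: a complete quadrangle, i.e. a copy of F⁻. An edge outside this copy passes through at
-- least two of the three diagonal points, so there is at most one, and it completes F⁻ to the Fano
-- plane or to the core of F₃. The vertices of degree 1 are then forced: if one of them were missing
-- (two of them, for the Fano plane), two vertices of the copy would dominate. Conversely, in F₁,
-- F₁⁻, F₂ and F₃ no two vertices dominate and the vertices 0, 1, 2 meet every edge.

open import Defs
open import Data.Sum using (_⊎_)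
open import Function.Bundles using (_⇔_)

open import Data.Bool using (true; false)
open import Data.Fin using (Fin; zero; suc; #_; splitAt; toℕ)
open import Data.Fin.Properties using (_≟_; any?; all?)
open import Data.Fin.Subset using (Subset; _∈_; _∉_; ∣_∣; ⁅_⁆; _∪_)
open import Data.Fin.Subset.Properties
  using (_∈?_; x∈⁅x⁆; x∈p∪q⁺; ∣⁅x⁆∣≡1;
         x∈p∧x≢y⇒x∈p-y; x∈p⇒∣p-x∣<∣p∣)
open import Data.List using (List; []; _∷_; _++_; length; map; filter; allFin)
open import Data.List.Membership.Propositional.Properties using (∈-map⁻; ∈-filter⁺; ∈-allFin)
open import Data.List.Properties using (length-++; length-map)
open import Data.List.Relation.Binary.Disjoint.Propositional using (Disjoint)
open import Data.List.Relation.Unary.All as All using (All; []; _∷_)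
open import Data.List.Relation.Unary.All.Properties using (all-filter) renaming (map⁺ to All-map⁺; ++⁺ to All-++⁺)
open import Data.List.Relation.Unary.AllPairs as AllPairs using (AllPairs; []; _∷_; allPairs?)
open import Data.List.Relation.Unary.AllPairs.Properties using () renaming (map⁺ to AllPairs-map⁺)
open import Data.List.Relation.Unary.Unique.Propositional using (Unique)
open import Data.List.Relation.Unary.Unique.Propositional.Properties
  using (allFin⁺; filter⁺) renaming (map⁺ to Unique-map⁺; ++⁺ to Unique-++⁺)
open import Data.Nat using (ℕ; zero; suc; _+_; _≤_; _<_; z≤n; s≤s; s≤s⁻¹)
open import Data.Nat.Properties using (≤-refl; ≤-reflexive; ≤-trans; ≤-antisym; +-mono-≤; +-suc; m≤n⇒m≤1+n; _≤?_; ≮⇒≥; <⇒≱)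
open import Data.Product using (_×_; _,_; proj₁; proj₂; ∃-syntax)
open import Data.Sum using (inj₁; inj₂; [_,_]; [_,_]′)
open import Data.Sum.Properties using (≡-dec)
import Data.Vec as Vec
open import Data.Vec using (Vec; []; _∷_)
open import Data.Vec.Functional using () renaming (_∷_ to infixr 5 _∷ᶠ_)
open import Data.Vec.Relation.Unary.All using ([]; _∷_)
open import Data.Vec.Relation.Unary.AllPairs using ([]; _∷_)
import Data.Vec.Relation.Unary.Unique.Propositional as VecUnique
open import Data.Vec.Relation.Unary.Unique.Propositional.Properties using (lookup-injective)
open import Function using (_∘_; id)
open import Function.Bundles using (mk⤖; mk⇔; module Bijection; module Equivalence)
open import Relation.Binary.PropositionalEquality
  using (_≡_; _≢_; refl; sym; trans; cong; subst; ≢-sym)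
open import Relation.Nullary using (¬_; Dec; yes; no; contradiction)
open import Relation.Nullary.Decidable using (True; toWitness; from-yes; decidable-stable; _×-dec_; _⊎-dec_; _→-dec_; ¬?)

-- Cardinalities

Unique⇒length≤∣∣ : ∀ {k} {s : Subset k} {xs} → Unique xs → All (_∈ s) xs → length xs ≤ ∣ s ∣
Unique⇒length≤∣∣ [] [] = z≤n
Unique⇒length≤∣∣ (x≢ ∷ xs!) (x∈s ∷ xs⊆s) = ≤-trans
  (s≤s (Unique⇒length≤∣∣ xs! (All.zipWith (λ (y∈s , x≢y) → x∈p∧x≢y⇒x∈p-y y∈s (≢-sym x≢y)) (xs⊆s , x≢))))
  (x∈p⇒∣p-x∣<∣p∣ x∈s)

∣p∪q∣≤∣p∣+∣q∣ : ∀ {k} (p q : Subset k) → ∣ p ∪ q ∣ ≤ ∣ p ∣ + ∣ q ∣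
∣p∪q∣≤∣p∣+∣q∣ [] [] = z≤n
∣p∪q∣≤∣p∣+∣q∣ (false ∷ p) (false ∷ q) = ∣p∪q∣≤∣p∣+∣q∣ p q
∣p∪q∣≤∣p∣+∣q∣ (false ∷ p) (true ∷ q) =
  ≤-trans (s≤s (∣p∪q∣≤∣p∣+∣q∣ p q)) (≤-reflexive (sym (+-suc ∣ p ∣ ∣ q ∣)))
∣p∪q∣≤∣p∣+∣q∣ (true ∷ p) (false ∷ q) = s≤s (∣p∪q∣≤∣p∣+∣q∣ p q)
∣p∪q∣≤∣p∣+∣q∣ (true ∷ p) (true ∷ q) =
  s≤s (≤-trans (∣p∪q∣≤∣p∣+∣q∣ p q) (+-mono-≤ (≤-refl {∣ p ∣}) (m≤n⇒m≤1+n ≤-refl)))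

∣⁅x⁆∪q∣≤1+∣q∣ : ∀ {k} (x : Fin k) q → ∣ ⁅ x ⁆ ∪ q ∣ ≤ suc ∣ q ∣
∣⁅x⁆∪q∣≤1+∣q∣ x q =
  ≤-trans (∣p∪q∣≤∣p∣+∣q∣ ⁅ x ⁆ q) (+-mono-≤ (≤-reflexive (∣⁅x⁆∣≡1 x)) (≤-refl {∣ q ∣}))

-- The pair may repeat a vertex, and for empty `D` it is the default `x₀` twice, so sizes 0, 1 and 2
-- are treated alike.
∣D∣<3⇒pair : ∀ {k} (D : Subset k) → Fin k → ∣ D ∣ < 3 →
  ∃[ u ] ∃[ w ] (∀ {x} → x ∈ D → x ≡ u ⊎ x ≡ w)
∣D∣<3⇒pair D x₀ D<3 with any? (_∈? D)
... | no D-empty = x₀ , x₀ , λ x∈D → contradiction (_ , x∈D) D-empty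
... | yes (u , u∈D) with any? (λ x → (x ∈? D) ×-dec ¬? (x ≟ u))
...   | no rest-empty = u , u , covers
  where
  covers : ∀ {x} → x ∈ D → x ≡ u ⊎ x ≡ u
  covers {x} x∈D with x ≟ u
  ... | yes x≡u = inj₁ x≡u
  ... | no x≢u = contradiction (x , x∈D , x≢u) rest-empty
...   | yes (w , w∈D , w≢u) = u , w , covers
  where
  covers : ∀ {x} → x ∈ D → x ≡ u ⊎ x ≡ w
  covers {x} x∈D with x ≟ u | x ≟ w
  ... | yes x≡u | _ = inj₁ x≡u
  ... | no _ | yes x≡w = inj₂ x≡w
  ... | no x≢u | no x≢w = contradiction
    (Unique⇒length≤∣∣ ((x≢u ∷ x≢w ∷ []) ∷ (≢-sym w≢u ∷ []) ∷ [] ∷ []) (x∈D ∷ u∈D ∷ w∈D ∷ []))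
    (<⇒≱ D<3)

AllPairs-All : ∀ {A : Set} {R : A → A → Set} {P : A → Set} {xs} →
  AllPairs R xs → All P xs → AllPairs (λ x y → R x y × P x × P y) xs
AllPairs-All [] [] = []
AllPairs-All (r ∷ rs) (p ∷ ps) = All.zipWith (λ (r , q) → r , p , q) (r , ps) ∷ AllPairs-All rs ps

-- Pairs that do not dominate

-- Absence of a dominating pair, in a decidable form; `u = w` covers single vertices. Where no
-- vertex is isolated, `v` differs from `u` and `w`, since an edge through `v` contains neither.
Far : Hypergraph → Set
Far H = ∀ u w → ∃[ v ] (∀ e → v ∈ edge H e → u ∉ edge H e × w ∉ edge H e)

¬dominated⇒Far : ∀ H → (∀ D → Dominating H D → 3 ≤ ∣ D ∣) → Far H
¬dominated⇒Far H big u w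
  with any? (λ v → all? λ e → v ∈? edge H e →-dec (¬? (u ∈? edge H e) ×-dec ¬? (w ∈? edge H e)))
... | yes v-far = v-far
... | no none = contradiction
  (≤-trans (big (⁅ u ⁆ ∪ ⁅ w ⁆) dominating)
    (≤-trans (∣⁅x⁆∪q∣≤1+∣q∣ u ⁅ w ⁆) (s≤s (≤-reflexive (∣⁅x⁆∣≡1 w)))))
  λ { (s≤s (s≤s ())) }
  where
  dominating : Dominating H (⁅ u ⁆ ∪ ⁅ w ⁆)
  dominating v _ with any? (λ e → (v ∈? edge H e) ×-dec ((u ∈? edge H e) ⊎-dec (w ∈? edge H e)))
  ... | yes (e , v∈e , inj₁ u∈e) = u , x∈p∪q⁺ (inj₁ (x∈⁅x⁆ u)) , e , u∈e , v∈e
  ... | yes (e , v∈e , inj₂ w∈e) = w , x∈p∪q⁺ (inj₂ (x∈⁅x⁆ w)) , e , w∈e , v∈e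
  ... | no v-far = contradiction
    (v , λ e v∈e → (λ u∈e → v-far (e , v∈e , inj₁ u∈e)) , (λ w∈e → v-far (e , v∈e , inj₂ w∈e)))
    none

Far⇒¬dominated : ∀ H → NoIsolated H → Fin (n H) → Far H → ∀ D → Dominating H D → 3 ≤ ∣ D ∣
Far⇒¬dominated H noIso x₀ far D dom = ≮⇒≥ λ D<3 →
  let u , w , covers = ∣D∣<3⇒pair D x₀ D<3
      v , v-far = far u w
      avoids : ∀ {x e} → v ∈ edge H e → x ∈ D → x ∉ edge H e
      avoids v∈e x∈D x∈e = [ (λ { refl → proj₁ (v-far _ v∈e) x∈e }) , (λ { refl → proj₂ (v-far _ v∈e) x∈e }) ] (covers x∈D)
      -- Any edge through `v` shows `v ∉ D`, so that `dom` applies to `v`.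
      e , v∈e = noIso v
      x , x∈D , f , x∈f , v∈f = dom v λ v∈D → avoids v∈e v∈D v∈e
  in avoids v∈f x∈D x∈f

Far? : ∀ H → Dec (Far H)
Far? H = all? λ u → all? λ w → any? λ v → all? λ e →
  v ∈? edge H e →-dec (¬? (u ∈? edge H e) ×-dec ¬? (w ∈? edge H e))

Far-≅ : ∀ {H F} → H ≅ F → Far F → Far H
Far-≅ {H} {F} (σ , forth , _) far u w =
  v , λ e v∈e → let e' , e⇔e' = forth e
                    to = λ x → Equivalence.to (e⇔e' x)
                    u∉ , w∉ = v-far e' (subst (_∈ edge F e') σv≡v' (to v v∈e))
                in u∉ ∘ to u , w∉ ∘ to w
  where
  open Bijection σ using (strictlySurjective) renaming (to to σ⟨_⟩)
  v' = proj₁ (far σ⟨ u ⟩ σ⟨ w ⟩)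
  v-far = proj₂ (far σ⟨ u ⟩ σ⟨ w ⟩)
  v = proj₁ (strictlySurjective v')
  σv≡v' = proj₂ (strictlySurjective v')

-- If every vertex lies on an edge, such a triple dominates; this gives the upper bound 3.
Transversal : (F : Hypergraph) → (a b c : Fin (n F)) → Set
Transversal F a b c = ∀ e → a ∈ edge F e ⊎ b ∈ edge F e ⊎ c ∈ edge F e

Transversal? : ∀ F a b c → Dec (Transversal F a b c)
Transversal? F a b c = all? λ e → (a ∈? edge F e) ⊎-dec (b ∈? edge F e) ⊎-dec (c ∈? edge F e)

≅⇒γ≡3 : ∀ {H F} → NoIsolated H → Far F → ∀ {a b c} → Transversal F a b c → H ≅ F → DominationNumber H 3
≅⇒γ≡3 {H} {F} noIso far {a} {b} {c} hits iso@(σ , forth , _) =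
  (D , dominating , ≤-antisym small (large D dominating)) , large
  where
  open Bijection σ using (strictlySurjective) renaming (to to σ⟨_⟩)
  σ⁻¹ = λ x → proj₁ (strictlySurjective x)
  D = ⁅ σ⁻¹ a ⁆ ∪ (⁅ σ⁻¹ b ⁆ ∪ ⁅ σ⁻¹ c ⁆)
  large = Far⇒¬dominated H noIso (σ⁻¹ a) (Far-≅ {H} {F} iso far)
  -- An inequality is enough, as `large` supplies the other one.
  small : ∣ D ∣ ≤ 3
  small = ≤-trans (∣⁅x⁆∪q∣≤1+∣q∣ (σ⁻¹ a) _)
    (s≤s (≤-trans (∣⁅x⁆∪q∣≤1+∣q∣ (σ⁻¹ b) _) (s≤s (≤-reflexive (∣⁅x⁆∣≡1 (σ⁻¹ c))))))
  pull : ∀ {e e'} → (∀ v → v ∈ edge H e ⇔ σ⟨ v ⟩ ∈ edge F e') → ∀ {x} → x ∈ edge F e' → σ⁻¹ x ∈ edge H e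
  pull {e' = e'} e⇔e' {x} x∈e' =
    Equivalence.from (e⇔e' _) (subst (_∈ edge F e') (sym (proj₂ (strictlySurjective x))) x∈e')
  dominating : Dominating H D
  dominating v _ with noIso v
  ... | e , v∈e with forth e
  ... | e' , e⇔e' with hits e'
  ... | inj₁ a∈e' = σ⁻¹ a , x∈p∪q⁺ (inj₁ (x∈⁅x⁆ _)) , e , pull e⇔e' a∈e' , v∈e
  ... | inj₂ (inj₁ b∈e') = σ⁻¹ b , x∈p∪q⁺ (inj₂ (x∈p∪q⁺ (inj₁ (x∈⁅x⁆ _)))) , e , pull e⇔e' b∈e' , v∈e
  ... | inj₂ (inj₂ c∈e') = σ⁻¹ c , x∈p∪q⁺ (inj₂ (x∈p∪q⁺ (inj₂ (x∈⁅x⁆ _)))) , e , pull e⇔e' c∈e' , v∈e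

-- Templates and their copies in a hypergraph

-- An injective placement of the points and lines of K in H. Incidences are only required to be
-- preserved; when K is intersecting and H is linear they are then also reflected.
record _↪_ (K H : Hypergraph) : Set where
  field
    point : Fin (n K) → Fin (n H)
    line : Fin (m K) → Fin (m H)
    point-injective : ∀ {i i'} → point i ≡ point i' → i ≡ i'
    line-injective : ∀ {j j'} → line j ≡ line j' → j ≡ j'
    incident : ∀ {i j} → i ∈ edge K j → point i ∈ edge H (line j)

open _↪_

↪-refl : ∀ {K} → K ↪ K
↪-refl = record
  { point = id ; line = id ; point-injective = id ; line-injective = id ; incident = id }

↪-trans : ∀ {K L H} → K ↪ L → L ↪ H → K ↪ H
↪-trans s e = record
  { point = point e ∘ point s
  ; line = line e ∘ line s
  ; point-injective = point-injective s ∘ point-injective e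
  ; line-injective = line-injective s ∘ line-injective e
  ; incident = incident e ∘ incident s
  }

power : ∀ {K} → K ↪ K → ℕ → K ↪ K
power s zero = ↪-refl
power s (suc k) = ↪-trans s (power s k)

Spans : ∀ {K H} → K ↪ H → Set
Spans e = ∀ f → ∃[ j ] line e j ≡ f

Spans-trans : ∀ {K L H} (s : K ↪ L) (e : L ↪ H) → Spans s → Spans e → Spans (↪-trans s e)
Spans-trans s e s-spans e-spans f with e-spans f
... | j , refl with s-spans j
... | i , refl = i , refl

Spans-power : ∀ {K} (s : K ↪ K) → Spans s → ∀ k → Spans (power s k)
Spans-power s spans zero f = f , refl
Spans-power s spans (suc k) = Spans-trans s (power s k) spans (Spans-power s spans k)

linesThrough : (K : Hypergraph) → Fin (n K) → List (Fin (m K))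
linesThrough K i = filter (λ j → i ∈? edge K j) (allFin (m K))

linesMeeting : (K : Hypergraph) → Fin (n K) → Fin (n K) → List (Fin (m K))
linesMeeting K i i' = filter (λ j → (i ∈? edge K j) ⊎-dec (i' ∈? edge K j)) (allFin (m K))

pointsOn : (K : Hypergraph) → Fin (m K) → List (Fin (n K))
pointsOn K j = filter (_∈? edge K j) (allFin (n K))

-- Since edges of `H` have at most 4 vertices, the image of a full line contains named vertices
-- only.
Full : (K : Hypergraph) → Fin (m K) → Set
Full K j = 4 ≤ length (pointsOn K j)

Full? : ∀ K j → Dec (Full K j)
Full? K j = 4 ≤? length (pointsOn K j)

Intersecting? : ∀ K → Dec (Intersecting K)
Intersecting? K = all? λ e → all? λ f → any? λ v → (v ∈? edge K e) ×-dec (v ∈? edge K f)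

NoIsolated? : ∀ K → Dec (NoIsolated K)
NoIsolated? K = all? λ v → any? λ e → v ∈? edge K e

Stray : ∀ {K H} → K ↪ H → Fin (n H) → Set
Stray e v = ∀ i → point e i ≢ v

-- If `K` is intersecting, `H` is linear and the copy spans, such a vertex has degree 1: two lines
-- of the copy meet in a named vertex only.
Private : ∀ {K H} → K ↪ H → Fin (m K) → Set
Private {H = H} e j = ∃[ v ] (v ∈ edge H (line e j) × Stray e v)

Private? : ∀ {K H} (e : K ↪ H) j → Dec (Private e j)
Private? {H = H} e j = any? λ v → (v ∈? edge H (line e j)) ×-dec all? λ i → ¬? (point e i ≟ v)

Outer : ∀ {K H} → K ↪ H → Fin (m H) → Set
Outer e f = ∀ j → line e j ≢ f

-- F arises from K by relabelling and by putting one new vertex on each of the lines `sprout`.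
record Sprouting (K F : Hypergraph) : Set where
  field
    shoots : ℕ
    sprout : Fin shoots → Fin (m K)
    sprout-injective : ∀ q q' → sprout q ≡ sprout q' → q ≡ q'
    lineOf : Fin (m F) → Fin (m K)
    lineOf-injective : ∀ j j' → lineOf j ≡ lineOf j' → j ≡ j'
    lineOf-surjective : ∀ l → ∃[ j ] lineOf j ≡ l
    origin : Fin (n F) → Fin (n K) ⊎ Fin shoots
    origin-injective : ∀ i i' → origin i ≡ origin i' → i ≡ i'
    origin-incident : ∀ i j → i ∈ edge F j →
      [ (λ c → c ∈ edge K (lineOf j)) , (λ q → lineOf j ≡ sprout q) ] (origin i)

-- Cores

fromLines : ∀ {k l} → Vec (List (Fin k)) l → Hypergraph
fromLines {k} {l} lines = record { n = k ; m = l ; edge = set ∘ Vec.lookup lines }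

-- The complete quadrangle with corners 0, 1, 3, 6 of degree 3. Its lines are the six sides, and
-- opposite sides cross in the diagonal points 2, 4, 5 of degree 2.
F⁻ : Hypergraph
F⁻ = fromLines {7}
  ( (# 0 ∷ # 1 ∷ # 2 ∷ []) ∷ (# 0 ∷ # 3 ∷ # 4 ∷ []) ∷ (# 0 ∷ # 5 ∷ # 6 ∷ [])
  ∷ (# 1 ∷ # 3 ∷ # 5 ∷ []) ∷ (# 1 ∷ # 4 ∷ # 6 ∷ []) ∷ (# 2 ∷ # 3 ∷ # 6 ∷ []) ∷ [])

-- The line of the diagonal points comes first, so that a copy is one of `F⁻` with an edge
-- prepended.
Fano : Hypergraph
Fano = fromLines {7}
  ( (# 2 ∷ # 4 ∷ # 5 ∷ [])
  ∷ (# 0 ∷ # 1 ∷ # 2 ∷ []) ∷ (# 0 ∷ # 3 ∷ # 4 ∷ []) ∷ (# 0 ∷ # 5 ∷ # 6 ∷ [])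
  ∷ (# 1 ∷ # 3 ∷ # 5 ∷ []) ∷ (# 1 ∷ # 4 ∷ # 6 ∷ []) ∷ (# 2 ∷ # 3 ∷ # 6 ∷ []) ∷ [])

-- F₃ without its vertices of degree 1: the vertices 9 and 10 of F₃ become 0 and 1, and i < 7 becomes i + 2.
F₃° : Hypergraph
F₃° = fromLines {9}
  ( (# 0 ∷ # 1 ∷ # 4 ∷ # 6 ∷ [])
  ∷ (# 2 ∷ # 3 ∷ # 4 ∷ []) ∷ (# 2 ∷ # 5 ∷ # 6 ∷ []) ∷ (# 0 ∷ # 2 ∷ # 7 ∷ # 8 ∷ [])
  ∷ (# 1 ∷ # 3 ∷ # 5 ∷ # 7 ∷ []) ∷ (# 3 ∷ # 6 ∷ # 8 ∷ []) ∷ (# 4 ∷ # 5 ∷ # 8 ∷ []) ∷ [])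

injective? : ∀ {k} {A : Set} → (∀ (x y : A) → Dec (x ≡ y)) → (f : Fin k → A) → Dec (∀ i i' → f i ≡ f i' → i ≡ i')
injective? _≟′_ f = all? λ i → all? λ i' → (f i ≟′ f i') →-dec (i ≟ i')

embedding? : ∀ K H (p : Fin (n K) → Fin (n H)) (l : Fin (m K) → Fin (m H)) →
  Dec ((∀ i i' → p i ≡ p i' → i ≡ i') × (∀ j j' → l j ≡ l j' → j ≡ j') ×
       (∀ i j → i ∈ edge K j → p i ∈ edge H (l j)))
embedding? K H p l = injective? _≟_ p ×-dec injective? _≟_ l ×-dec
  (all? λ i → all? λ j → (i ∈? edge K j) →-dec (p i ∈? edge H (l j)))

embedding : ∀ K H p l → {True (embedding? K H p l)} → K ↪ H
embedding K H p l {ok} =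
  let p-inj , l-inj , inc = toWitness ok
  in record { point = p ; line = l ; point-injective = p-inj _ _ ; line-injective = l-inj _ _
            ; incident = inc _ _ }

-- Fixes the vertex 0 and permutes the diagonal points 2, 4, 5 cyclically.
F⁻-rotation : F⁻ ↪ F⁻
F⁻-rotation = embedding F⁻ F⁻
  (Vec.lookup (# 0 ∷ # 3 ∷ # 4 ∷ # 6 ∷ # 5 ∷ # 2 ∷ # 1 ∷ []))
  (Vec.lookup (# 1 ∷ # 2 ∷ # 0 ∷ # 5 ∷ # 3 ∷ # 4 ∷ []))

-- Permutes the seven lines cyclically.
Fano-rotation : Fano ↪ Fano
Fano-rotation = embedding Fano Fano
  (Vec.lookup (# 1 ∷ # 3 ∷ # 5 ∷ # 2 ∷ # 0 ∷ # 6 ∷ # 4 ∷ []))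
  (Vec.lookup (# 3 ∷ # 4 ∷ # 1 ∷ # 5 ∷ # 6 ∷ # 2 ∷ # 0 ∷ []))

sprouting? : ∀ K F {p} (sprout : Fin p → Fin (m K)) (lineOf : Fin (m F) → Fin (m K))
  (origin : Fin (n F) → Fin (n K) ⊎ Fin p) →
  Dec ((∀ q q' → sprout q ≡ sprout q' → q ≡ q') ×
       (∀ j j' → lineOf j ≡ lineOf j' → j ≡ j') ×
       (∀ l → ∃[ j ] lineOf j ≡ l) ×
       (∀ i i' → origin i ≡ origin i' → i ≡ i') ×
       (∀ i j → i ∈ edge F j → [ (λ c → c ∈ edge K (lineOf j)) , (λ q → lineOf j ≡ sprout q) ] (origin i)))
sprouting? K F sprout lineOf origin =
  injective? _≟_ sprout ×-dec injective? _≟_ lineOf ×-dec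
  (all? λ l → any? λ j → lineOf j ≟ l) ×-dec
  injective? (≡-dec _≟_ _≟_) origin ×-dec
  (all? λ i → all? λ j → (i ∈? edge F j) →-dec at (origin i) j)
  where
  at : ∀ o j → Dec ([ (λ c → c ∈ edge K (lineOf j)) , (λ q → lineOf j ≡ sprout q) ] o)
  at (inj₁ c) j = c ∈? edge K (lineOf j)
  at (inj₂ q) j = lineOf j ≟ sprout q

sprouting : ∀ K F {p} (sprout : Fin p → _) lineOf origin →
  {True (sprouting? K F sprout lineOf origin)} → Sprouting K F
sprouting K F sprout lineOf origin {ok} =
  let a , b , c , d , e = toWitness ok
  in record { sprout = sprout ; sprout-injective = a ; lineOf = lineOf ; lineOf-injective = b
            ; lineOf-surjective = c ; origin = origin ; origin-injective = d ; origin-incident = e }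

-- F₁, F₂ and F₃ list the line 0 of their cores last.
cycle : Fin 7 → Fin 7
cycle = Vec.lookup (# 1 ∷ # 2 ∷ # 3 ∷ # 4 ∷ # 5 ∷ # 6 ∷ # 0 ∷ [])

F⁻⇝F₁⁻ : Sprouting F⁻ F₁⁻
F⁻⇝F₁⁻ = sprouting F⁻ F₁⁻ id id (splitAt 7)

Fano⇝F₁ : Sprouting Fano F₁
Fano⇝F₁ = sprouting Fano F₁ cycle cycle (splitAt 7)

Fano⇝F₂ : Sprouting Fano F₂
Fano⇝F₂ = sprouting Fano F₂ suc cycle (splitAt 7)

F₃°⇝F₃ : Sprouting F₃° F₃
F₃°⇝F₃ = sprouting F₃° F₃ sprout cycle origin
  where
  sprout : Fin 4 → Fin 7
  sprout = Vec.lookup (# 1 ∷ # 2 ∷ # 5 ∷ # 6 ∷ [])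
  origin : Fin 13 → Fin 9 ⊎ Fin 4
  origin = Vec.lookup
    ( inj₁ (# 2) ∷ inj₁ (# 3) ∷ inj₁ (# 4) ∷ inj₁ (# 5) ∷ inj₁ (# 6) ∷ inj₁ (# 7) ∷ inj₁ (# 8)
    ∷ inj₂ (# 0) ∷ inj₂ (# 1) ∷ inj₁ (# 0) ∷ inj₁ (# 1) ∷ inj₂ (# 2) ∷ inj₂ (# 3) ∷ [])

Forces : (K : Hypergraph) → (j l : Fin (m K)) → Set
Forces K j l = ∃[ a ] ∃[ b ]
  (∀ c → ∃[ j' ] (c ∈ edge K j' × (a ∈ edge K j' ⊎ b ∈ edge K j'))) ×
  (∀ j' → (j' ≡ j ⊎ j' ≡ l) ⊎ (a ∈ edge K j' ⊎ b ∈ edge K j') ⊎ Full K j')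

Forces? : ∀ K j l → Dec (Forces K j l)
Forces? K j l = any? λ a → any? λ b →
  (all? λ c → any? λ j' → (c ∈? edge K j') ×-dec ((a ∈? edge K j') ⊎-dec (b ∈? edge K j'))) ×-dec
  (all? λ j' → ((j' ≟ j) ⊎-dec (j' ≟ l)) ⊎-dec ((a ∈? edge K j') ⊎-dec (b ∈? edge K j')) ⊎-dec Full? K j')

diagonal : Fin 3 → Fin 7
diagonal = Vec.lookup (# 2 ∷ # 4 ∷ # 5 ∷ [])

linesBut : Fin 6 → List (Fin 6)
linesBut r = filter (λ j → ¬? (j ≟ r)) (allFin 6)

-- Finite facts about the cores and the four hypergraphs

abstract

  -- The two corners off the side `j` meet the other five sides.
  F⁻-forces : ∀ j → Forces F⁻ j j
  F⁻-forces = from-yes (all? λ j → Forces? F⁻ j j)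

  -- Let `p` be the crossing of `j` and `l`. The two other points of the third line through `p` meet
  -- every line except `j` and `l`.
  Fano-forces : ∀ j l → j ≡ l ⊎ Forces Fano j l
  Fano-forces = from-yes (all? λ j → all? λ l → (j ≟ l) ⊎-dec Forces? Fano j l)

  F₃°-forces : ∀ q → Forces F₃° (Sprouting.sprout F₃°⇝F₃ q) (Sprouting.sprout F₃°⇝F₃ q)
  F₃°-forces = from-yes (all? λ q → Forces? F₃° (Sprouting.sprout F₃°⇝F₃ q) (Sprouting.sprout F₃°⇝F₃ q))

  diagonal-degree : ∀ i → 2 ≤ length (linesThrough F⁻ (diagonal i))
  diagonal-degree = from-yes (all? λ i → 2 ≤? length (linesThrough F⁻ (diagonal i)))

  third : ∀ (k k' : Fin 3) → ∃[ i ] (k ≢ i × k' ≢ i)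
  third = from-yes (all? {3} λ k → all? {3} λ k' → any? {3} λ i → ¬? (k ≟ i) ×-dec ¬? (k' ≟ i))

  -- A power of the rotation takes 5 to `diagonal k`, hence 2 and 4 to the two other diagonal
  -- points.
  F⁻-align : ∀ k → ∃[ s ] (∃[ i ] (k ≢ i × point {F⁻} {F⁻} s (# 2) ≡ diagonal i)) ×
    (∃[ i ] (k ≢ i × point s (# 4) ≡ diagonal i))
  F⁻-align k = power F⁻-rotation (toℕ (proj₁ (turn k))) , proj₂ (turn k)
    where
    turn : ∀ k → ∃[ t ] (let s = power F⁻-rotation (toℕ {3} t) in
      (∃[ i ] (k ≢ i × point s (# 2) ≡ diagonal i)) × (∃[ i ] (k ≢ i × point s (# 4) ≡ diagonal i)))
    turn = from-yes (all? {3} λ k → any? {3} λ t →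
      (any? λ i → ¬? (k ≟ i) ×-dec (point (power F⁻-rotation (toℕ {3} t)) (# 2) ≟ diagonal i)) ×-dec
      (any? λ i → ¬? (k ≟ i) ×-dec (point (power F⁻-rotation (toℕ {3} t)) (# 4) ≟ diagonal i)))

  -- Take for `r` a side through the third diagonal point: no two of the remaining five sides cross
  -- there, and all other crossings are corners or the two given diagonal points.
  F⁻-five-lines : ∀ k i → k ≡ i ⊎ ∃[ r ] (5 ≤ length (linesBut r) ×
    AllPairs (λ j j' → ∀ c → c ∈ edge F⁻ j → c ∈ edge F⁻ j' →
      3 ≤ length (linesThrough F⁻ c) ⊎ c ≡ diagonal k ⊎ c ≡ diagonal i) (linesBut r))
  F⁻-five-lines = from-yes (all? {3} λ k → all? {3} λ i → (k ≟ i) ⊎-dec any? λ r → (5 ≤? length (linesBut r)) ×-dec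
    allPairs? (λ j j' → all? λ c → (c ∈? edge F⁻ j) →-dec ((c ∈? edge F⁻ j') →-dec
      ((3 ≤? length (linesThrough F⁻ c)) ⊎-dec (c ≟ diagonal k) ⊎-dec (c ≟ diagonal i)))) (linesBut r))

  -- Two corners meet five sides; a corner and a diagonal point share at most one side; two diagonal
  -- points share none.
  F⁻-separation : ∀ i i' → i ≡ i' ⊎ 4 ≤ length (linesMeeting F⁻ i i')
  F⁻-separation = from-yes (all? λ i → all? λ i' → (i ≟ i') ⊎-dec (4 ≤? length (linesMeeting F⁻ i i')))

  F⁻-lines₂₃ : ∀ j → j ≡ # 2 ⊎ j ≡ # 3 → ∀ i → i ∈ edge F⁻ j → 3 ≤ length (linesThrough F⁻ i) ⊎ i ≡ # 5
  F⁻-lines₂₃ = from-yes (all? λ j → ((j ≟ # 2) ⊎-dec (j ≟ # 3)) →-dec (all? λ i → (i ∈? edge F⁻ j) →-dec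
    ((3 ≤? length (linesThrough F⁻ i)) ⊎-dec (i ≟ # 5))))

  Fano-line₀ : ∀ i → i ∈ edge Fano zero → i ≡ # 2 ⊎ i ≡ # 4 ⊎ i ≡ # 5
  Fano-line₀ = from-yes (all? λ i → (i ∈? edge Fano zero) →-dec ((i ≟ # 2) ⊎-dec (i ≟ # 4) ⊎-dec (i ≟ # 5)))

  Fano-transitive : ∀ j → ∃[ s ] (line {Fano} {Fano} s zero ≡ j × Spans s × ∀ c → ∃[ i ] point s i ≡ c)
  Fano-transitive j = power Fano-rotation (toℕ t) , proj₂ (turn j) ,
    Spans-power Fano-rotation (from-yes (all? λ j → any? λ i → line Fano-rotation i ≟ j)) (toℕ t) , onto t
    where
    turn : ∀ j → ∃[ t ] line (power Fano-rotation (toℕ {7} t)) zero ≡ j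
    turn = from-yes (all? λ j → any? λ t → line (power Fano-rotation (toℕ {7} t)) zero ≟ j)
    t : Fin 7
    t = proj₁ (turn j)
    onto : ∀ t c → ∃[ i ] point (power Fano-rotation (toℕ {7} t)) i ≡ c
    onto = from-yes (all? λ t → all? λ c → any? λ i → point (power Fano-rotation (toℕ {7} t)) i ≟ c)

  F₃°-lines₀ : ∀ j → zero ∈ edge F₃° j → j ≡ # 0 ⊎ j ≡ # 3
  F₃°-lines₀ = from-yes (all? λ j → (zero ∈? edge F₃° j) →-dec ((j ≟ # 0) ⊎-dec (j ≟ # 3)))

  F₃°-lines₁ : ∀ j → suc zero ∈ edge F₃° j → j ≡ # 0 ⊎ j ≡ # 4
  F₃°-lines₁ = from-yes (all? λ j → (suc zero ∈? edge F₃° j) →-dec ((j ≟ # 0) ⊎-dec (j ≟ # 4)))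

  F₃°-line₀ : ∀ i → suc (suc i) ∈ edge F₃° zero → i ≡ # 2 ⊎ i ≡ # 4
  F₃°-line₀ = from-yes (all? λ i → (suc (suc i) ∈? edge F₃° zero) →-dec ((i ≟ # 2) ⊎-dec (i ≟ # 4)))

  F₃°-inner : ∀ i j → suc (suc i) ∈ edge F₃° (suc j) → i ∈ edge F⁻ j
  F₃°-inner = from-yes (all? λ i → all? λ j → (suc (suc i) ∈? edge F₃° (suc j)) →-dec (i ∈? edge F⁻ j))

  F₁-full : ∀ j → Full F₁ j
  F₁-full = from-yes (all? (Full? F₁))

  F₁⁻-full : ∀ j → Full F₁⁻ j
  F₁⁻-full = from-yes (all? (Full? F₁⁻))

  F₂-full : ∀ j → Full F₂ j ⊎ j ≡ # 6
  F₂-full = from-yes (all? λ j → Full? F₂ j ⊎-dec (j ≟ # 6))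

  F₃-full : ∀ j → Full F₃ j
  F₃-full = from-yes (all? (Full? F₃))

  F₂-origin : ∀ c → ∃[ i ] Sprouting.origin Fano⇝F₂ i ≡ inj₁ c
  F₂-origin = from-yes (all? λ c → any? λ i → ≡-dec _≟_ _≟_ (Sprouting.origin Fano⇝F₂ i) (inj₁ c))

  F⁻-int : Intersecting F⁻
  F⁻-int = from-yes (Intersecting? F⁻)

  Fano-int : Intersecting Fano
  Fano-int = from-yes (Intersecting? Fano)

  F₃°-int : Intersecting F₃°
  F₃°-int = from-yes (Intersecting? F₃°)

  F₁-int : Intersecting F₁
  F₁-int = from-yes (Intersecting? F₁)

  F₁⁻-int : Intersecting F₁⁻
  F₁⁻-int = from-yes (Intersecting? F₁⁻)

  F₂-int : Intersecting F₂
  F₂-int = from-yes (Intersecting? F₂)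

  F₃-int : Intersecting F₃
  F₃-int = from-yes (Intersecting? F₃)

  F⁻-noIso : NoIsolated F⁻
  F⁻-noIso = from-yes (NoIsolated? F⁻)

  F₁-noIso : NoIsolated F₁
  F₁-noIso = from-yes (NoIsolated? F₁)

  F₁⁻-noIso : NoIsolated F₁⁻
  F₁⁻-noIso = from-yes (NoIsolated? F₁⁻)

  F₂-noIso : NoIsolated F₂
  F₂-noIso = from-yes (NoIsolated? F₂)

  F₃-noIso : NoIsolated F₃
  F₃-noIso = from-yes (NoIsolated? F₃)

-- Hypergraphs in which no two vertices dominate

module NonDominated (H : Hypergraph) (lin : Linear H) (int : Intersecting H)
  (size : ∀ e → ∣ edge H e ∣ ≤ 4) (noIso : NoIsolated H) (far : Far H) where

  meet : Fin (m H) → Fin (m H) → Fin (n H)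
  meet e f = proj₁ (int e f)

  meetˡ : ∀ e f → meet e f ∈ edge H e
  meetˡ e f = proj₁ (proj₂ (int e f))

  meetʳ : ∀ e f → meet e f ∈ edge H f
  meetʳ e f = proj₂ (proj₂ (int e f))

  Spread : Fin (m H) → List (Fin (m H)) → Set
  Spread g = AllPairs (λ e f → meet g e ≢ meet g f)

  -- No vertex of `vs` lies on an edge of `es`, so `vs` and the crossings with `es` are different
  -- vertices of `g`.
  spread-bound : ∀ {g es vs} → Spread g es → Unique vs → All (_∈ edge H g) vs →
    All (λ v → All (λ e → v ∉ edge H e) es) vs → length vs + length es ≤ 4
  spread-bound {g} {es} {vs} spread vs! vs⊆g vs-off = ≤-trans (≤-reflexive (sym len)) (≤-trans
    (Unique⇒length≤∣∣ {xs = vs ++ map (meet g) es}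
      (Unique-++⁺ vs! (AllPairs-map⁺ spread) disjoint)
      (All-++⁺ vs⊆g (All-map⁺ (All.universal (meetˡ g) es))))
    (size g))
    where
    len : length (vs ++ map (meet g) es) ≡ length vs + length es
    len = trans (length-++ vs) (cong (length vs +_) (length-map (meet g) es))
    disjoint : Disjoint vs (map (meet g) es)
    disjoint (v∈vs , v∈meets) with ∈-map⁻ (meet g) v∈meets
    ... | e , e∈es , refl = All.lookup (All.lookup vs-off v∈vs) e∈es (meetʳ g e)

  -- Two edges through `x` that met `g` in the same vertex would share that vertex and `x`.
  pencil-spread : ∀ {g es x} → Unique es → All (λ e → x ∈ edge H e) es → x ∉ edge H g → Spread g es
  pencil-spread {g} es! x∈es x∉g = AllPairs.map
    (λ {e} {f} (e≢f , x∈e , x∈f) same → x∉g (subst (_∈ edge H g)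
      (lin e f e≢f _ _ (meetʳ g e) x∈e (subst (_∈ edge H f) (sym same) (meetʳ g f)) x∈f) (meetˡ g e)))
    (AllPairs-All es! x∈es)

  -- An edge through a vertex `v` not dominated by `x` contains `v` and a separate crossing with
  -- each edge through `x`.
  degree≤3 : ∀ {es x} → Unique es → All (λ e → x ∈ edge H e) es → length es ≤ 3
  degree≤3 {es} {x} es! x∈es with far x x
  ... | v , v-far with noIso v
  ... | g , v∈g = s≤s⁻¹ (spread-bound (pencil-spread es! x∈es (proj₁ (v-far g v∈g))) ([] ∷ [])
    (v∈g ∷ []) (All.map (λ x∈e v∈e → proj₁ (v-far _ v∈e) x∈e) x∈es ∷ []))

  Concurrent : Fin (n H) → Fin (m H) → Fin (m H) → Fin (m H) → Set
  Concurrent x e f g = (x ∈ edge H e × x ∈ edge H f × x ∈ edge H g) × (e ≢ f × e ≢ g × f ≢ g)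

  -- Otherwise take p = e₁ ∩ e₂, q = e₃ ∩ e₄ and a vertex v that p and q leave undominated: an
  -- edge e₅ through v has v and four further vertices.
  concurrent-edges : Fin (m H) → ∃[ x ] ∃[ e ] ∃[ f ] ∃[ g ] Concurrent x e f g
  concurrent-edges e₁
    with any? (λ x → any? λ e → any? λ f → any? λ g →
      ((x ∈? edge H e) ×-dec (x ∈? edge H f) ×-dec (x ∈? edge H g)) ×-dec
      (¬? (e ≟ f) ×-dec ¬? (e ≟ g) ×-dec ¬? (f ≟ g)))
  ... | yes triple = triple
  ... | no none = contradiction
    (spread-bound {e₅} {e₁ ∷ e₂ ∷ e₃ ∷ e₄ ∷ []} {v ∷ []} spread ([] ∷ []) (v∈e₅ ∷ []) (off ∷ []))
    λ { (s≤s (s≤s (s≤s (s≤s ())))) }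
    where
    -- `meet e₁ e₁` merely names some vertex of `e₁`; `e₂` avoids it and so differs from `e₁`.
    v₂ = proj₁ (far (meet e₁ e₁) (meet e₁ e₁))
    far₂ = proj₂ (far (meet e₁ e₁) (meet e₁ e₁))
    e₂ = proj₁ (noIso v₂)
    v₂∈e₂ = proj₂ (noIso v₂)
    e₁≢e₂ : e₁ ≢ e₂
    e₁≢e₂ eq = proj₁ (far₂ e₂ v₂∈e₂) (subst (λ e → meet e₁ e₁ ∈ edge H e) eq (meetˡ e₁ e₁))
    p = meet e₁ e₂
    v₃ = proj₁ (far p p)
    far₃ = proj₂ (far p p)
    e₃ = proj₁ (noIso v₃)
    v₃∈e₃ = proj₂ (noIso v₃)
    -- Avoiding `p` separates `e₄` from `e₁` and `e₂`; avoiding `v₃` separates it from `e₃`.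
    v₄ = proj₁ (far p v₃)
    far₄ = proj₂ (far p v₃)
    e₄ = proj₁ (noIso v₄)
    v₄∈e₄ = proj₂ (noIso v₄)
    q = meet e₃ e₄
    v = proj₁ (far p q)
    far₅ = proj₂ (far p q)
    e₅ = proj₁ (noIso v)
    v∈e₅ = proj₂ (noIso v)
    p∉e₃ = proj₁ (far₃ e₃ v₃∈e₃)
    p∉e₄ = proj₁ (far₄ e₄ v₄∈e₄)
    separates : ∀ {x e f} → x ∈ edge H e → x ∉ edge H f → e ≢ f
    separates x∈e x∉f refl = x∉f x∈e
    distinct : Unique (e₁ ∷ e₂ ∷ e₃ ∷ e₄ ∷ [])
    distinct =
      (e₁≢e₂ ∷ separates (meetˡ e₁ e₂) p∉e₃ ∷ separates (meetˡ e₁ e₂) p∉e₄ ∷ []) ∷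
      (separates (meetʳ e₁ e₂) p∉e₃ ∷ separates (meetʳ e₁ e₂) p∉e₄ ∷ []) ∷
      (separates v₃∈e₃ (proj₂ (far₄ e₄ v₄∈e₄)) ∷ []) ∷ [] ∷ []
    off : All (λ e → v ∉ edge H e) (e₁ ∷ e₂ ∷ e₃ ∷ e₄ ∷ [])
    off = (λ v∈ → proj₁ (far₅ _ v∈) (meetˡ e₁ e₂)) ∷ (λ v∈ → proj₁ (far₅ _ v∈) (meetʳ e₁ e₂)) ∷
      (λ v∈ → proj₂ (far₅ _ v∈) (meetˡ e₃ e₄)) ∷ (λ v∈ → proj₂ (far₅ _ v∈) (meetʳ e₃ e₄)) ∷ []
    spread : Spread e₅ (e₁ ∷ e₂ ∷ e₃ ∷ e₄ ∷ [])
    -- Two edges crossing `e₅` in the same vertex would be concurrent with `e₅`.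
    spread = AllPairs.map
      (λ {e} {f} (e≢f , v∉e , v∉f) same → none (meet e₅ e , e₅ , e , f ,
        (meetˡ e₅ e , meetʳ e₅ e , subst (_∈ edge H f) (sym same) (meetʳ e₅ f)) ,
        ≢-sym (λ { refl → v∉e v∈e₅ }) , ≢-sym (λ { refl → v∉f v∈e₅ }) , e≢f))
      (AllPairs-All distinct off)

  -- Each edge is named by the two corners it joins. Distinctness of the points follows from that of
  -- the sides, through `separated`.
  record Quadrangle : Set where
    field
      x y b c : Fin (n H)
      xy xb xc yb yc bc : Fin (m H)
      distinct : VecUnique.Unique (xy ∷ xb ∷ xc ∷ yb ∷ yc ∷ bc ∷ [])
      on-xy : x ∈ edge H xy × y ∈ edge H xy
      on-xb : x ∈ edge H xb × b ∈ edge H xb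
      on-xc : x ∈ edge H xc × c ∈ edge H xc
      on-yb : y ∈ edge H yb × b ∈ edge H yb
      on-yc : y ∈ edge H yc × c ∈ edge H yc
      on-bc : b ∈ edge H bc × c ∈ edge H bc

  -- Let z ∈ g₁ be undominated by x, z₂ ∈ g₂ by {x , z} and z₃ ∈ g₃ by {x , y}, where y = g₁ ∩ g₂.
  -- Each gₜ has only one vertex off the three edges through x, so the gₜ meet pairwise on these.
  quadrangle : Fin (m H) → Quadrangle
  quadrangle e₀ with concurrent-edges e₀
  ... | x , E₀ , E₁ , E₂ , (x∈E₀ , x∈E₁ , x∈E₂) , (E₀≢E₁ , E₀≢E₂ , E₁≢E₂) = record
    { x = x ; y = y ; b = b ; c = c
    ; xy = E i ; xb = E j ; xc = E k ; yb = g₁ ; yc = g₂ ; bc = g₃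
    ; distinct =
        (E-distinct i≢j ∷ E-distinct i≢k ∷ E≢ i x∉g₁ ∷ E≢ i x∉g₂ ∷ E≢ i x∉g₃ ∷ []) ∷
        (E-distinct j≢k ∷ E≢ j x∉g₁ ∷ E≢ j x∉g₂ ∷ E≢ j x∉g₃ ∷ []) ∷
        (E≢ k x∉g₁ ∷ E≢ k x∉g₂ ∷ E≢ k x∉g₃ ∷ []) ∷
        (g₁≢g₂ ∷ g₁≢g₃ ∷ []) ∷ (g₂≢g₃ ∷ []) ∷ [] ∷ []
    ; on-xy = x∈E i , y∈E
    ; on-xb = x∈E j , b∈E
    ; on-xc = x∈E k , c∈E
    ; on-yb = y∈g₁ , b∈g₁
    ; on-yc = y∈g₂ , c∈g₂
    ; on-bc = b∈g₃ , c∈g₃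
    }
    where
    Es : Vec (Fin (m H)) 3
    Es = E₀ ∷ E₁ ∷ E₂ ∷ []
    E : Fin 3 → Fin (m H)
    E = Vec.lookup Es
    E-distinct : ∀ {i j} → i ≢ j → E i ≢ E j
    E-distinct i≢j = i≢j ∘ lookup-injective ((E₀≢E₁ ∷ E₀≢E₂ ∷ []) ∷ (E₁≢E₂ ∷ []) ∷ [] ∷ []) _ _
    x∈E : ∀ i → x ∈ edge H (E i)
    x∈E zero = x∈E₀
    x∈E (suc zero) = x∈E₁
    x∈E (suc (suc zero)) = x∈E₂
    E≢ : ∀ i {g} → x ∉ edge H g → E i ≢ g
    E≢ i x∉g refl = x∉g (x∈E i)

    -- Otherwise `g` would contain `z`, `v` and three crossings with the edges through `x`.
    onPencil : ∀ {g z v} → z ∈ edge H g → (∀ e → z ∈ edge H e → x ∉ edge H e) →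
      v ∈ edge H g → z ≢ v → ∃[ i ] v ∈ edge H (E i)
    onPencil {g} {z} {v} z∈g z-far v∈g z≢v with any? (λ i → v ∈? edge H (E i))
    ... | yes found = found
    ... | no v-off = contradiction
      (spread-bound {g} {E₀ ∷ E₁ ∷ E₂ ∷ []} {z ∷ v ∷ []}
        (pencil-spread ((E₀≢E₁ ∷ E₀≢E₂ ∷ []) ∷ (E₁≢E₂ ∷ []) ∷ [] ∷ []) (x∈E₀ ∷ x∈E₁ ∷ x∈E₂ ∷ []) (z-far g z∈g))
        ((z≢v ∷ []) ∷ [] ∷ []) (z∈g ∷ v∈g ∷ [])
        (((λ z∈ → z-far E₀ z∈ x∈E₀) ∷ (λ z∈ → z-far E₁ z∈ x∈E₁) ∷ (λ z∈ → z-far E₂ z∈ x∈E₂) ∷ []) ∷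
         ((λ v∈ → v-off (# 0 , v∈)) ∷ (λ v∈ → v-off (# 1 , v∈)) ∷ (λ v∈ → v-off (# 2 , v∈)) ∷ []) ∷ []))
      λ { (s≤s (s≤s (s≤s (s≤s ())))) }

    z = proj₁ (far x x)
    z-far = λ e z∈e → proj₁ (proj₂ (far x x) e z∈e)
    g₁ = proj₁ (noIso z)
    z∈g₁ = proj₂ (noIso z)
    z₂ = proj₁ (far x z)
    g₂ = proj₁ (noIso z₂)
    z₂-far = proj₂ (far x z) g₂ (proj₂ (noIso z₂))
    z∉g₂ = proj₂ z₂-far
    y = meet g₁ g₂
    y∈g₁ = meetˡ g₁ g₂
    y∈g₂ = meetʳ g₁ g₂
    z₃ = proj₁ (far x y)
    z₃-far = proj₂ (far x y)
    g₃ = proj₁ (noIso z₃)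
    z₃∈g₃ = proj₂ (noIso z₃)
    y∉g₃ = proj₂ (z₃-far g₃ z₃∈g₃)
    b = meet g₁ g₃
    b∈g₁ = meetˡ g₁ g₃
    b∈g₃ = meetʳ g₁ g₃
    c = meet g₂ g₃
    c∈g₂ = meetˡ g₂ g₃
    c∈g₃ = meetʳ g₂ g₃
    x∉g₁ = z-far g₁ z∈g₁
    x∉g₂ = proj₁ z₂-far
    x∉g₃ = proj₁ (z₃-far g₃ z₃∈g₃)
    g₁≢g₂ : g₁ ≢ g₂
    g₁≢g₂ eq = z∉g₂ (subst (λ g → z ∈ edge H g) eq z∈g₁)
    g₁≢g₃ : g₁ ≢ g₃
    g₁≢g₃ eq = y∉g₃ (subst (λ g → y ∈ edge H g) eq y∈g₁)
    g₂≢g₃ : g₂ ≢ g₃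
    g₂≢g₃ eq = y∉g₃ (subst (λ g → y ∈ edge H g) eq y∈g₂)

    on-y : ∃[ i ] y ∈ edge H (E i)
    on-y = onPencil z∈g₁ z-far y∈g₁ λ z≡y → z∉g₂ (subst (_∈ edge H g₂) (sym z≡y) y∈g₂)
    on-b : ∃[ j ] b ∈ edge H (E j)
    -- `z₃` differs from `b`, as it shares no edge with `y` while `b` does; the same holds for `c`.
    on-b = onPencil z₃∈g₃ (λ e → proj₁ ∘ z₃-far e) b∈g₃ λ z₃≡b →
      proj₂ (z₃-far g₁ (subst (_∈ edge H g₁) (sym z₃≡b) b∈g₁)) y∈g₁
    on-c : ∃[ k ] c ∈ edge H (E k)
    on-c = onPencil z₃∈g₃ (λ e → proj₁ ∘ z₃-far e) c∈g₃ λ z₃≡c →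
      proj₂ (z₃-far g₂ (subst (_∈ edge H g₂) (sym z₃≡c) c∈g₂)) y∈g₂
    i = proj₁ on-y
    y∈E = proj₂ on-y
    j = proj₁ on-b
    b∈E = proj₂ on-b
    k = proj₁ on-c
    c∈E = proj₂ on-c
    i≢j : i ≢ j
    -- Otherwise `b` and `y` lie on both `E i` and `g₁`, so `y = b` is on `g₃`.
    i≢j i≡j = y∉g₃ (subst (_∈ edge H g₃)
      (lin (E i) g₁ (E≢ i x∉g₁) b y (subst (λ t → b ∈ edge H (E t)) (sym i≡j) b∈E) y∈E b∈g₁ y∈g₁) b∈g₃)
    i≢k : i ≢ k
    i≢k i≡k = y∉g₃ (subst (_∈ edge H g₃)
      (lin (E i) g₂ (E≢ i x∉g₂) c y (subst (λ t → c ∈ edge H (E t)) (sym i≡k) c∈E) y∈E c∈g₂ y∈g₂) c∈g₃)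
    j≢k : j ≢ k
    -- Otherwise `b` and `c` lie on both `E k` and `g₃`, so `b = c` is the crossing `y` of `g₁` and
    -- `g₂`.
    j≢k j≡k = y∉g₃ (subst (_∈ edge H g₃) (lin g₁ g₂ g₁≢g₂ b y b∈g₁ y∈g₁ b∈g₂ y∈g₂) b∈g₃)
      where
      b∈g₂ : b ∈ edge H g₂
      b∈g₂ = subst (_∈ edge H g₂)
        (lin (E k) g₃ (E≢ k x∉g₃) c b c∈E (subst (λ t → b ∈ edge H (E t)) j≡k b∈E) c∈g₃ b∈g₃) c∈g₂

  -- Copies of intersecting templates in `H`

  module _ {K : Hypergraph} (K-int : Intersecting K) (e : K ↪ H) where

    -- A line through `i` other than `j` crosses `j` in a point of `K`; by linearity its image is
    -- that of `i`.
    reflects : NoIsolated K → ∀ {i j} → point e i ∈ edge H (line e j) → i ∈ edge K j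
    reflects K-noIso {i} {j} pi∈j with K-noIso i
    ... | j₁ , i∈j₁ with j₁ ≟ j
    ... | yes refl = i∈j₁
    ... | no j₁≢j with K-int j₁ j
    ... | i' , i'∈j₁ , i'∈j = subst (_∈ edge K j) (sym (point-injective e
      (lin (line e j₁) (line e j) (j₁≢j ∘ line-injective e) _ _
        (incident e i∈j₁) (incident e i'∈j₁) pi∈j (incident e i'∈j)))) i'∈j

    crossing : ∀ {j j' v} → j ≢ j' → v ∈ edge H (line e j) → v ∈ edge H (line e j') →
      ∃[ c ] (c ∈ edge K j × c ∈ edge K j' × point e c ≡ v)
    crossing {j} {j'} j≢j' v∈j v∈j' with K-int j j'
    ... | c , c∈j , c∈j' = c , c∈j , c∈j' , lin (line e j) (line e j') (j≢j' ∘ line-injective e) _ _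
      (incident e c∈j) v∈j (incident e c∈j') v∈j'

    sprout-↪ : ∀ {F} (S : Sprouting K F) → (∀ q → Private e (Sprouting.sprout S q)) → F ↪ H
    sprout-↪ {F} S private' = record
      { point = at ∘ origin
      ; line = line e ∘ lineOf
      ; point-injective = origin-injective _ _ ∘ at-injective _ _
      ; line-injective = lineOf-injective _ _ ∘ line-injective e
      ; incident = λ {i} {j} i∈j → at-incident j (origin i) (origin-incident i j i∈j)
      }
      where
      open Sprouting S
      at : Fin (n K) ⊎ Fin shoots → Fin (n H)
      at = [ point e , (λ q → proj₁ (private' q)) ]
      at-injective : ∀ o o' → at o ≡ at o' → o ≡ o'
      at-injective (inj₁ c) (inj₁ c') eq = cong inj₁ (point-injective e eq)
      at-injective (inj₁ c) (inj₂ q) eq = contradiction eq (proj₂ (proj₂ (private' q)) c)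
      at-injective (inj₂ q) (inj₁ c) eq = contradiction (sym eq) (proj₂ (proj₂ (private' q)) c)
      at-injective (inj₂ q) (inj₂ q') eq with private' q | private' q' | q ≟ q'
      ... | _ | _ | yes refl = refl
      ... | v , v∈ , stray | v' , v'∈ , _ | no q≢q'
        -- A vertex private to two lines would be their crossing, which is named.
        with crossing (q≢q' ∘ sprout-injective q q') v∈ (subst (_∈ edge H _) (sym eq) v'∈)
      ... | c , _ , _ , pc≡v = contradiction pc≡v (stray c)
      at-incident : ∀ j o → [ (λ c → c ∈ edge K (lineOf j)) , (λ q → lineOf j ≡ sprout q) ] o →
        at o ∈ edge H (line e (lineOf j))
      at-incident j (inj₁ c) c∈ = incident e c∈
      at-incident j (inj₂ q) eq = subst (λ l → at (inj₂ q) ∈ edge H (line e l)) (sym eq) (proj₁ (proj₂ (private' q)))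

    sprout-Spans : ∀ {F} (S : Sprouting K F) private' → Spans e → Spans (sprout-↪ S private')
    sprout-Spans S _ spans f with spans f
    ... | l , refl with Sprouting.lineOf-surjective S l
    ... | j , refl = j , refl

    -- `point e` is onto because every vertex lies on a line of the copy, and `σ` is its inverse.
    spanning⇒≅ : NoIsolated K → Spans e → (∀ j v → v ∈ edge H (line e j) → ∃[ i ] point e i ≡ v) → H ≅ K
    spanning⇒≅ K-noIso spans named =
      mk⤖ {to = σ} (σ-injective , λ i → point e i , λ { refl → point-injective e (point-σ (point e i)) }) ,
      (λ f → let j , j≡f = spans f in j , λ v → subst (λ g → v ∈ edge H g ⇔ σ v ∈ edge K j) j≡f (same j v)) ,
      (λ j → line e j , same j)
      where
      find : ∀ v → ∃[ i ] point e i ≡ v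
      find v with noIso v
      ... | f , v∈f with spans f
      ... | j , refl = named j v v∈f
      σ : Fin (n H) → Fin (n K)
      σ = proj₁ ∘ find
      point-σ : ∀ v → point e (σ v) ≡ v
      point-σ = proj₂ ∘ find
      σ-injective : ∀ {v w} → σ v ≡ σ w → v ≡ w
      σ-injective {v} {w} eq = trans (sym (point-σ v)) (trans (cong (point e) eq) (point-σ w))
      same : ∀ j v → v ∈ edge H (line e j) ⇔ σ v ∈ edge K j
      same j v = mk⇔
        (λ v∈j → reflects K-noIso (subst (_∈ edge H (line e j)) (sym (point-σ v)) v∈j))
        (λ σv∈j → subst (_∈ edge H (line e j)) (point-σ v) (incident e σv∈j))

    Full⇒¬Stray : ∀ {j v} → Full K j → v ∈ edge H (line e j) → ¬ Stray e v
    Full⇒¬Stray {j} {v} full v∈j stray = <⇒≱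
      (s≤s (≤-trans full (≤-reflexive (sym (length-map (point e) (pointsOn K j))))))
      (≤-trans (Unique⇒length≤∣∣ {xs = v ∷ map (point e) (pointsOn K j)}
        (All-map⁺ (All.universal (λ i → ≢-sym (stray i)) (pointsOn K j)) ∷
          Unique-map⁺ (point-injective e) (filter⁺ (_∈? edge K j) (allFin⁺ (n K))))
        (v∈j ∷ All-map⁺ (All.map (incident e) (all-filter (_∈? edge K j) (allFin (n K))))))
        (size (line e j)))

    Full⇒named : ∀ j → Full K j → ∀ v → v ∈ edge H (line e j) → ∃[ i ] point e i ≡ v
    Full⇒named j full v v∈j with any? (λ i → point e i ≟ v)
    ... | yes named = named
    ... | no unnamed = contradiction (λ i pi≡v → unnamed (i , pi≡v)) (Full⇒¬Stray full v∈j)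

    -- If the named points a and b meet every line except j, l and full ones, then what they leave
    -- undominated is a private vertex of j or of l.
    forced : Spans e → ∀ {j l} → Forces K j l → Private e j ⊎ Private e l
    forced spans {j} {l} (a , b , hits-points , hits-lines) with far (point e a) (point e b)
    ... | v , v-far with noIso v
    ... | f , v∈f with spans f
    ... | j' , refl = locate (hits-lines j')
      where
      -- Every named vertex shares a line with `a` or `b`, so `v` is none of them.
      stray : Stray e v
      stray c refl with hits-points c
      ... | _ , c∈ , inj₁ a∈ = proj₁ (v-far _ (incident e c∈)) (incident e a∈)
      ... | _ , c∈ , inj₂ b∈ = proj₂ (v-far _ (incident e c∈)) (incident e b∈)
      locate : (j' ≡ j ⊎ j' ≡ l) ⊎ (a ∈ edge K j' ⊎ b ∈ edge K j') ⊎ Full K j' → Private e j ⊎ Private e l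
      locate (inj₁ (inj₁ refl)) = inj₁ (v , v∈f , stray)
      locate (inj₁ (inj₂ refl)) = inj₂ (v , v∈f , stray)
      locate (inj₂ (inj₁ (inj₁ a∈))) = contradiction (incident e a∈) (proj₁ (v-far _ v∈f))
      locate (inj₂ (inj₁ (inj₂ b∈))) = contradiction (incident e b∈) (proj₂ (v-far _ v∈f))
      locate (inj₂ (inj₂ full)) = contradiction stray (Full⇒¬Stray full v∈f)

    forced-same : Spans e → ∀ {j} → Forces K j j → Private e j
    forced-same spans forces = [ id , id ] (forced spans forces)

  module _ {K : Hypergraph} {P : Fin (n K) → Fin (n H)} {L : Fin (m K) → Fin (m H)}
    (L-injective : ∀ {j j'} → L j ≡ L j' → j ≡ j')
    (inc : ∀ {i j} → i ∈ edge K j → P i ∈ edge H (L j)) where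

    -- A common image would lie on four edges. This is stated for bare maps because it is what
    -- proves `P` injective.
    separated : ∀ {i i'} → 4 ≤ length (linesMeeting K i i') → P i ≢ P i'
    separated {i} {i'} many eq = <⇒≱ many (≤-trans (≤-reflexive (sym (length-map L (linesMeeting K i i'))))
      (degree≤3 {x = P i}
        (Unique-map⁺ L-injective (filter⁺ meets? (allFin⁺ (m K))))
        (All-map⁺ (All.map (λ {j} → [ inc , (λ i'∈j → subst (_∈ edge H (L j)) (sym eq) (inc i'∈j)) ])
          (all-filter meets? (allFin (m K)))))))
      where
      meets? : ∀ j → Dec (i ∈ edge K j ⊎ i' ∈ edge K j)
      meets? j = (i ∈? edge K j) ⊎-dec (i' ∈? edge K j)

  module _ {K : Hypergraph} (e : K ↪ H) where

    linesThrough-Unique : ∀ i → Unique (map (line e) (linesThrough K i))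
    linesThrough-Unique i = Unique-map⁺ (line-injective e) (filter⁺ (λ j → i ∈? edge K j) (allFin⁺ (m K)))

    linesThrough-∈ : ∀ i → All (λ g → point e i ∈ edge H g) (map (line e) (linesThrough K i))
    linesThrough-∈ i = All-map⁺ (All.map (incident e) (all-filter (λ j → i ∈? edge K j) (allFin (m K))))

    outer-≢ : ∀ {f} → Outer e f → ∀ js → All (f ≢_) (map (line e) js)
    outer-≢ outer js = All-map⁺ (All.universal (λ j → ≢-sym (outer j)) js)

    -- Together with `f`, the lines through `i` would give its image degree 4.
    outer-avoids : ∀ {f} → Outer e f → ∀ {i} → 3 ≤ length (linesThrough K i) → point e i ∉ edge H f
    outer-avoids outer {i} three pi∈f = <⇒≱
      (s≤s (≤-trans three (≤-reflexive (sym (length-map (line e) (linesThrough K i))))))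
      (degree≤3 (outer-≢ outer (linesThrough K i) ∷ linesThrough-Unique i) (pi∈f ∷ linesThrough-∈ i))

    outer-pair : ∀ {f f'} → Outer e f → Outer e f' → ∀ {i} → 2 ≤ length (linesThrough K i) →
      point e i ∈ edge H f → point e i ∈ edge H f' → f ≡ f'
    outer-pair {f} {f'} outer outer' {i} two pi∈f pi∈f' with f ≟ f'
    ... | yes f≡f' = f≡f'
    ... | no f≢f' = contradiction
      (degree≤3 ((f≢f' ∷ outer-≢ outer (linesThrough K i)) ∷ outer-≢ outer' (linesThrough K i) ∷ linesThrough-Unique i)
        (pi∈f ∷ pi∈f' ∷ linesThrough-∈ i))
      (<⇒≱ (s≤s (s≤s (≤-trans two (≤-reflexive (sym (length-map (line e) (linesThrough K i))))))))

  -- The copy of `F⁻` and an edge outside it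

  F⁻-copy : Quadrangle → F⁻ ↪ H
  F⁻-copy Q = record
    { point = P ; line = L
    ; point-injective = λ {i} {i'} eq →
        [ id , (λ many → contradiction eq (separated {F⁻} {P} {L} L-injective (λ {i} {j} → inc {i} {j}) {i} {i'} many)) ]′ (F⁻-separation i i')
    ; line-injective = L-injective ; incident = λ {i} {j} → inc {i} {j} }
    where
    open Quadrangle Q
    P : Fin 7 → Fin (n H)
    -- Corners go to 0, 1, 3, 6; positions 2, 4, 5 hold the crossings of opposite sides.
    P = Vec.lookup (x ∷ y ∷ meet xy bc ∷ b ∷ meet xb yc ∷ meet xc yb ∷ c ∷ [])
    L : Fin 6 → Fin (m H)
    L = Vec.lookup (xy ∷ xb ∷ xc ∷ yb ∷ yc ∷ bc ∷ [])
    L-injective : ∀ {j j'} → L j ≡ L j' → j ≡ j'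
    L-injective = lookup-injective distinct _ _
    on : ∀ j → All (λ i → P i ∈ edge H (L j)) (pointsOn F⁻ j)
    on zero = proj₁ on-xy ∷ proj₂ on-xy ∷ meetˡ xy bc ∷ []
    on (suc zero) = proj₁ on-xb ∷ proj₂ on-xb ∷ meetˡ xb yc ∷ []
    on (suc (suc zero)) = proj₁ on-xc ∷ meetˡ xc yb ∷ proj₂ on-xc ∷ []
    on (suc (suc (suc zero))) = proj₁ on-yb ∷ proj₂ on-yb ∷ meetʳ xc yb ∷ []
    on (suc (suc (suc (suc zero)))) = proj₁ on-yc ∷ meetʳ xb yc ∷ proj₂ on-yc ∷ []
    on (suc (suc (suc (suc (suc zero))))) = meetʳ xy bc ∷ proj₁ on-bc ∷ proj₂ on-bc ∷ []
    inc : ∀ {i j} → i ∈ edge F⁻ j → P i ∈ edge H (L j)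
    inc {i} {j} i∈j = All.lookup (on j) (∈-filter⁺ (_∈? edge F⁻ j) (∈-allFin i) i∈j)

  -- If f missed two diagonal points, it would meet the four lines through them and a fifth line in
  -- five different vertices.
  misses≤1 : (e : F⁻ ↪ H) → ∀ {f} → Outer e f →
    ∀ {k i} → k ≢ i → point e (diagonal k) ∉ edge H f → point e (diagonal i) ∈ edge H f
  misses≤1 e {f} outer {k} {i} k≢i k∉f with point e (diagonal i) ∈? edge H f
  ... | yes i∈f = i∈f
  ... | no i∉f with F⁻-five-lines k i
  ... | inj₁ k≡i = contradiction k≡i k≢i
  ... | inj₂ (r , five , apart) = contradiction
    (spread-bound {f} {map (line e) (linesBut r)} {[]}
      (AllPairs-map⁺ (AllPairs.zipWith (λ {j} {j'} → distinct j j')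
        (filter⁺ (λ j → ¬? (j ≟ r)) (allFin⁺ 6) , apart)))
      [] [] [])
    (<⇒≱ (≤-trans five (≤-reflexive (sym (length-map (line e) (linesBut r))))))
    where
    distinct : ∀ j j' → j ≢ j' × (∀ c → c ∈ edge F⁻ j → c ∈ edge F⁻ j' →
        3 ≤ length (linesThrough F⁻ c) ⊎ c ≡ diagonal k ⊎ c ≡ diagonal i) →
      meet f (line e j) ≢ meet f (line e j')
    distinct j j' (j≢j' , on-both) eq
      -- Equal crossings with `f` would put a crossing of two sides on `f`: a corner, excluded by
      -- its degree, or a missed diagonal point.
      with crossing F⁻-int e j≢j' (meetʳ f (line e j)) (subst (_∈ edge H (line e j')) (sym eq) (meetʳ f (line e j')))
    ... | c , c∈j , c∈j' , pc≡ with on-both c c∈j c∈j'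
    ... | inj₁ three = outer-avoids e outer three (subst (_∈ edge H f) (sym pc≡) (meetˡ f (line e j)))
    ... | inj₂ (inj₁ refl) = k∉f (subst (_∈ edge H f) (sym pc≡) (meetˡ f (line e j)))
    ... | inj₂ (inj₂ refl) = i∉f (subst (_∈ edge H f) (sym pc≡) (meetˡ f (line e j)))

  missed : (e : F⁻ ↪ H) → ∀ {f} → Outer e f →
    ∃[ k ] (∀ i → k ≢ i → point e (diagonal i) ∈ edge H f)
  missed e {f} outer with any? (λ k → ¬? (point e (diagonal k) ∈? edge H f))
  ... | yes (k , k∉f) = k , λ i k≢i → misses≤1 e outer k≢i k∉f
  -- If `f` contains all three diagonal points, any `k` will do.
  ... | no none = zero , λ i _ → decidable-stable (point e (diagonal i) ∈? edge H f) (λ i∉f → none (i , i∉f))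

  -- Each edge misses at most one diagonal point, so both contain a common one, which already lies
  -- on two sides.
  outer-unique : (e : F⁻ ↪ H) → ∀ {f f'} → Outer e f → Outer e f' → f ≡ f'
  outer-unique e outer outer' with missed e outer | missed e outer'
  ... | k , f-on | k' , f'-on with third k k'
  ... | i , k≢i , k'≢i = outer-pair e outer outer' (diagonal-degree i) (f-on i k≢i) (f'-on i k'≢i)

  align : (e : F⁻ ↪ H) → ∀ {f} → Outer e f →
    ∃[ e' ] (Outer {F⁻} e' f × point e' (# 2) ∈ edge H f × point e' (# 4) ∈ edge H f)
  align e {f} outer with missed e outer
  ... | k , on with F⁻-align k
  ... | s , (i , k≢i , i≡) , (i' , k≢i' , i'≡) = ↪-trans s e , outer ∘ line s ,
    subst (λ c → point e c ∈ edge H f) (sym i≡) (on i k≢i) ,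
    subst (λ c → point e c ∈ edge H f) (sym i'≡) (on i' k≢i')

  ∷-injective : ∀ {k l} {x : Fin l} {f : Fin k → Fin l} → (∀ i → f i ≢ x) → (∀ {i j} → f i ≡ f j → i ≡ j) →
    ∀ {i j} → (x ∷ᶠ f) i ≡ (x ∷ᶠ f) j → i ≡ j
  ∷-injective x∉f f-inj {zero} {zero} _ = refl
  ∷-injective x∉f f-inj {zero} {suc j} eq = contradiction (sym eq) (x∉f j)
  ∷-injective x∉f f-inj {suc i} {zero} eq = contradiction eq (x∉f i)
  ∷-injective x∉f f-inj {suc i} {suc j} eq = cong suc (f-inj eq)

  ∷-Spans : (e : F⁻ ↪ H) → ∀ {f} → Outer e f → ∀ g → ∃[ j ] (f ∷ᶠ line e) j ≡ g
  ∷-Spans e {f} outer g with any? (λ j → line e j ≟ g)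
  ... | yes (j , eq) = suc j , eq
  ... | no none = zero , outer-unique e outer λ j eq → none (j , eq)

  Fano-copy : (e : F⁻ ↪ H) → ∀ {f} → Outer e f → point e (# 2) ∈ edge H f → point e (# 4) ∈ edge H f →
    point e (# 5) ∈ edge H f → Fano ↪ H
  Fano-copy e {f} outer 2∈f 4∈f 5∈f = record
    { point = point e ; line = f ∷ᶠ line e
    ; point-injective = point-injective e
    ; line-injective = ∷-injective outer (line-injective e)
    ; incident = λ {i} {j} → inc i j }
    where
    inc : ∀ i j → i ∈ edge Fano j → point e i ∈ edge H ((f ∷ᶠ line e) j)
    inc i (suc j) i∈j = incident e i∈j
    inc i zero i∈0 with Fano-line₀ i i∈0
    ... | inj₁ refl = 2∈f
    ... | inj₂ (inj₁ refl) = 4∈f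
    ... | inj₂ (inj₂ refl) = 5∈f

  F₃°-copy : (e : F⁻ ↪ H) → ∀ {f} → Outer e f → point e (# 2) ∈ edge H f → point e (# 4) ∈ edge H f →
    point e (# 5) ∉ edge H f → F₃° ↪ H
  F₃°-copy e {f} outer 2∈f 4∈f 5∉f = record
    { point = p₀ ∷ᶠ p₁ ∷ᶠ point e ; line = f ∷ᶠ line e
    ; point-injective = ∷-injective p₀-new (∷-injective (unnamed (inj₂ refl)) (point-injective e))
    ; line-injective = ∷-injective outer (line-injective e)
    ; incident = λ {i} {j} → inc i j }
    where
    p₀ = meet f (line e (# 2))
    p₁ = meet f (line e (# 3))
    unnamed : ∀ {j} → j ≡ # 2 ⊎ j ≡ # 3 → ∀ i → point e i ≢ meet f (line e j)
    unnamed {j} j≡ i eq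
      with F⁻-lines₂₃ j j≡ i (reflects F⁻-int e F⁻-noIso (subst (_∈ edge H (line e j)) (sym eq) (meetʳ f (line e j))))
    ... | inj₁ three = outer-avoids e outer three (subst (_∈ edge H f) (sym eq) (meetˡ f (line e j)))
    ... | inj₂ refl = 5∉f (subst (_∈ edge H f) (sym eq) (meetˡ f (line e j)))
    p₀-new : ∀ i → (p₁ ∷ᶠ point e) i ≢ p₀
    p₀-new (suc i) = unnamed (inj₁ refl) i
    p₀-new zero eq with crossing F⁻-int e (λ ()) (meetʳ f (line e (# 2)))
      (subst (_∈ edge H (line e (# 3))) eq (meetʳ f (line e (# 3))))
    ... | c , _ , _ , pc≡ = unnamed (inj₁ refl) c pc≡
    inc : ∀ i j → i ∈ edge F₃° j → (p₀ ∷ᶠ p₁ ∷ᶠ point e) i ∈ edge H ((f ∷ᶠ line e) j)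
    inc zero j 0∈j with F₃°-lines₀ j 0∈j
    ... | inj₁ refl = meetˡ f (line e (# 2))
    ... | inj₂ refl = meetʳ f (line e (# 2))
    inc (suc zero) j 1∈j with F₃°-lines₁ j 1∈j
    ... | inj₁ refl = meetˡ f (line e (# 3))
    ... | inj₂ refl = meetʳ f (line e (# 3))
    inc (suc (suc i)) zero i∈0 with F₃°-line₀ i i∈0
    ... | inj₁ refl = 2∈f
    ... | inj₂ refl = 4∈f
    inc (suc (suc i)) (suc j) i∈j = incident e (F₃°-inner i j i∈j)

  -- From a spanning core to one of the four hypergraphs

  F⁻-spanning : (e : F⁻ ↪ H) → Spans e → H ≅ F₁⁻
  F⁻-spanning e spans = spanning⇒≅ F₁⁻-int e' F₁⁻-noIso (sprout-Spans F⁻-int e F⁻⇝F₁⁻ privates spans)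
    (λ j → Full⇒named F₁⁻-int e' j (F₁⁻-full j))
    where
    privates : ∀ j → Private e j
    privates j = forced-same F⁻-int e spans (F⁻-forces j)
    e' = sprout-↪ F⁻-int e F⁻⇝F₁⁻ privates

  F₃°-spanning : (e : F₃° ↪ H) → Spans e → H ≅ F₃
  F₃°-spanning e spans = spanning⇒≅ F₃-int e' F₃-noIso (sprout-Spans F₃°-int e F₃°⇝F₃ privates spans)
    (λ j → Full⇒named F₃-int e' j (F₃-full j))
    where
    privates : ∀ q → Private e (Sprouting.sprout F₃°⇝F₃ q)
    privates q = forced-same F₃°-int e spans (F₃°-forces q)
    e' = sprout-↪ F₃°-int e F₃°⇝F₃ privates

  Fano-all-private : (e : Fano ↪ H) → Spans e → (∀ j → Private e j) → H ≅ F₁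
  Fano-all-private e spans privates = spanning⇒≅ F₁-int e' F₁-noIso
    (sprout-Spans Fano-int e Fano⇝F₁ (privates ∘ cycle) spans)
    (λ j → Full⇒named F₁-int e' j (F₁-full j))
    where
    e' = sprout-↪ Fano-int e Fano⇝F₁ (privates ∘ cycle)

  Fano-no-private₀ : (e : Fano ↪ H) → Spans e → ¬ Private e zero → H ≅ F₂
  Fano-no-private₀ e spans none = spanning⇒≅ F₂-int e' F₂-noIso
    (sprout-Spans Fano-int e Fano⇝F₂ privates spans) named
    where
    privates : ∀ j → Private e (suc j)
    privates j with Fano-forces zero (suc j)
    ... | inj₂ forces = [ (λ p → contradiction p none) , id ] (forced Fano-int e spans forces)
    e' = sprout-↪ Fano-int e Fano⇝F₂ privates
    named : ∀ j v → v ∈ edge H (line e' j) → ∃[ i ] point e' i ≡ v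
    named j v v∈j with F₂-full j
    ... | inj₁ full = Full⇒named F₂-int e' j full v v∈j
    ... | inj₂ refl with any? (λ c → point e c ≟ v)
    ... | no unnamed = contradiction (v , v∈j , λ c eq → unnamed (c , eq)) none
    ... | yes (c , refl) with F₂-origin c
    ... | i , eq = i , cong [ point e , (λ q → proj₁ (privates q)) ] eq

  Fano-spanning : (e : Fano ↪ H) → Spans e → H ≅ F₁ ⊎ H ≅ F₂
  Fano-spanning e spans with any? (λ j → ¬? (Private? e j))
  ... | no none = inj₁ (Fano-all-private e spans λ j →
    decidable-stable (Private? e j) (λ ¬private → none (j , ¬private)))
  ... | yes (j , ¬private) with Fano-transitive j
  ... | s , 0↦j , s-spans , s-onto = inj₂ (Fano-no-private₀ (↪-trans s e) (Spans-trans s e s-spans spans)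
    λ (v , v∈ , stray) → ¬private (v , subst (λ l → v ∈ edge H (line e l)) 0↦j v∈ ,
      λ c eq → let i , i↦c = s-onto c in stray i (trans (cong (point e) i↦c) eq)))

  -- Three cases: no outer edge, an outer edge through exactly two diagonal points, or one through
  -- all three.
  classify : Fin (m H) → (H ≅ F₁) ⊎ (H ≅ F₁⁻) ⊎ (H ≅ F₂) ⊎ (H ≅ F₃)
  classify e₀ with F⁻-copy (quadrangle e₀)
  ... | e with any? (λ f → all? λ j → ¬? (line e j ≟ f))
  ... | no none = inj₂ (inj₁ (F⁻-spanning e λ f →
    decidable-stable (any? λ j → line e j ≟ f) (λ missing → none (f , λ j eq → missing (j , eq)))))
  ... | yes (f , outer) with align e outer
  ... | e' , outer' , 2∈f , 4∈f with point e' (# 5) ∈? edge H f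
  ... | no 5∉f = inj₂ (inj₂ (inj₂ (F₃°-spanning (F₃°-copy e' outer' 2∈f 4∈f 5∉f) (∷-Spans e' outer'))))
  ... | yes 5∈f with Fano-spanning (Fano-copy e' outer' 2∈f 4∈f 5∈f) (∷-Spans e' outer')
  ... | inj₁ H≅F₁ = inj₁ H≅F₁
  ... | inj₂ H≅F₂ = inj₂ (inj₂ (inj₁ H≅F₂))

-- Lower bound for the four hypergraphs, and the equivalence

abstract

  F₁-far : Far F₁
  F₁-far = from-yes (Far? F₁)

  F₁⁻-far : Far F₁⁻
  F₁⁻-far = from-yes (Far? F₁⁻)

  F₂-far : Far F₂
  F₂-far = from-yes (Far? F₂)

  F₃-far : Far F₃
  F₃-far = from-yes (Far? F₃)

theorem3p2 : (H : Hypergraph) → WellFormed H → Linear H → Intersecting H →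
    HasRank H 4 → NoIsolated H →
    (DominationNumber H 3 ⇔ ((H ≅ F₁) ⊎ (H ≅ F₁⁻) ⊎ (H ≅ F₂) ⊎ (H ≅ F₃)))
theorem3p2 H _ lin int (size , e₀ , _) noIso = mk⇔
  (λ (_ , large) → NonDominated.classify H lin int size noIso (¬dominated⇒Far H large) e₀)
  λ where
    (inj₁ H≅F₁) → ≅⇒γ≡3 noIso F₁-far {# 0} {# 1} {# 2} (from-yes (Transversal? F₁ (# 0) (# 1) (# 2))) H≅F₁
    (inj₂ (inj₁ H≅F₁⁻)) → ≅⇒γ≡3 noIso F₁⁻-far {# 0} {# 1} {# 2} (from-yes (Transversal? F₁⁻ (# 0) (# 1) (# 2))) H≅F₁⁻
    (inj₂ (inj₂ (inj₁ H≅F₂))) → ≅⇒γ≡3 noIso F₂-far {# 0} {# 1} {# 2} (from-yes (Transversal? F₂ (# 0) (# 1) (# 2))) H≅F₂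
    (inj₂ (inj₂ (inj₂ H≅F₃))) → ≅⇒γ≡3 noIso F₃-far {# 0} {# 1} {# 2} (from-yes (Transversal? F₃ (# 0) (# 1) (# 2))) H≅F₃
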